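{- Let $t$ and $u$ be $\lambda$-terms (terms without explicit substitutions). Then $t \equiv_{S} u$ if and only if $t \equiv_{V} u$, where $\equiv_S$ is the contextual equivalence induced by weak reduction $\to_{w}$ of the silly substitution calculus and $\equiv_V$ is the contextual equivalence induced by call-by-value reduction $\to_{\beta_v}$.
   Context: Silly substitution calculus (SSC). Terms: $t,u,s ::= x \mid \lambda x.t \mid t\,u \mid t[x\backslash u]$, where $t[x\backslash u]$ is an explicit substitution (ES) binding $x$ in $t$; $\lambda x.t$ also binds $x$ in $t$; terms are taken up to $\alpha$-renaming; $\mathrm{fv}(t[x\backslash u]) = (\mathrm{fv}(t)\setminus\{x\})\cup \mathrm{fv}(u)$. Values are abstractions only: $v ::= \lambda x.t$. Substitution contexts: $S ::= \langle\cdot\rangle \mid S[x\backslash u]$. Weak contexts: $W ::= \langle\cdot\rangle \mid W\,t \mid t\,W \mid t[x\backslash W] \mid W[x\backslash u]$ (the hole is never under an abstraction). $W\langle t\rangle$ denotes plugging (which may capture variables); $W\langle\langle t\rangle\rangle$ means plugging where $W$ does not capture the free variables of $t$. Root rules: (multiplicative) $S\langle \lambda x.t\rangle u \mapsto_m S\langle t[x\backslash u]\rangle$; (exponential) $W\langle\langle x\rangle\rangle[x\backslash u] \mapsto_{e} W\langle\langle u\rangle\rangle[x\backslash u]$ for $W$ a weak context; (GC by value) $t[x\backslash S\langle v\rangle] \mapsto_{gcv} S\langle t\rangle$ if $x\notin\mathrm{fv}(t)$, $v$ a value. $\to_{wm}$, $\to_{we}$, $\to_{wgcv}$ are the closures of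 these root rules under weak contexts, and $\to_w := \to_{wm}\cup\to_{we}\cup\to_{wgcv}$. Call-by-value $\lambda$-calculus: $\lambda$-terms $t ::= x\mid \lambda x.t\mid tu$, values are abstractions, CbV contexts $V ::= \langle\cdot\rangle \mid t V \mid V t$, root rule $(\lambda x.t)v \mapsto_{\beta_v} t\{x:=v\}$ (meta-level capture-avoiding substitution) for $v$ a value, and $\to_{\beta_v}$ its closure under CbV contexts. Contextual equivalence: for a rewriting relation $\to$ on a language of terms, with contexts being terms of that language with exactly one hole (placed anywhere, including under abstractions), $t\equiv u$ iff for every context $C$ such that $C\langle t\rangle$ and $C\langle u\rangle$ are closed, $C\langle t\rangle$ is weakly $\to$-normalizing (reduces to a $\to$-normal form) iff $C\langle u\rangle$ is. $\equiv_S$ is this for $\to_w$ on SSC terms and contexts, $\equiv_V$ for $\to_{\beta_v}$ on $\lambda$-terms and $\lambda$-contexts. -}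

module Defs where

open import Data.Nat using (ℕ; zero; suc; pred; _+_; _≟_)
open import Data.Sum using (_⊎_)
open import Function using (_⇔_)
open import Level using (0ℓ)
open import Relation.Binary using (Rel)
open import Relation.Binary.Construct.Union using (_∪_)
open import Relation.Binary.PropositionalEquality using (_≡_)
open import Relation.Binary.Rewriting using (HasNormalForm)
open import Relation.Nullary using (¬_; yes; no)

-- Terms up to α-renaming are de Bruijn terms over ℕ.  The names of free
-- variables are natural numbers: under d binders, the index i < d is a bound
-- variable and the index d + x is the free variable named x.

Ren : Set
Ren = ℕ → ℕ

ext : Ren → Ren
ext ρ zero    = zero
ext ρ (suc i) = suc (ρ i)

-- Turns the free name x into the bound index 0 of a new binder; every other
-- name y keeps its name, hence becomes the index suc y under that binder.
bind : ℕ → Ren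
bind x y with x ≟ y
... | yes _ = zero
... | no  _ = suc y

-- HasNormalForm is weak normalization of a single term.
ContextualEquivalence :
  {Term Context : Set} →
  (plug : Context → Term → Term) (Closed : Term → Set) →
  Rel Term 0ℓ → Rel Term 0ℓ
ContextualEquivalence plug Closed _⟶_ t u =
  ∀ C → Closed (plug C t) → Closed (plug C u) →
  HasNormalForm _⟶_ (plug C t) ⇔ HasNormalForm _⟶_ (plug C u)

module CbV where

  data Term : Set where
    var : ℕ → Term
    lam : Term → Term
    app : Term → Term → Term

  data Value : Term → Set where
    lam : ∀ t → Value (lam t)

  rename : Ren → Term → Term
  rename ρ (var x)   = var (ρ x)
  rename ρ (lam t)   = lam (rename (ext ρ) t)
  rename ρ (app t u) = app (rename ρ t) (rename ρ u)

  exts : (ℕ → Term) → ℕ → Term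
  exts σ zero    = var zero
  exts σ (suc i) = rename suc (σ i)

  subst : (ℕ → Term) → Term → Term
  subst σ (var x)   = σ x
  subst σ (lam t)   = lam (subst (exts σ) t)
  subst σ (app t u) = app (subst σ t) (subst σ u)

  -- t{x:=u} where x is the index 0 of t; the other indices are lowered, since
  -- the binder of x disappears.
  infix 8 _[0:=_]
  _[0:=_] : Term → Term → Term
  t [0:= u ] = subst (λ { zero → u ; (suc i) → var i }) t

  infix 4 _∈fv_
  _∈fv_ : ℕ → Term → Set
  x ∈fv var y   = x ≡ y
  x ∈fv lam t   = suc x ∈fv t
  x ∈fv app t u = x ∈fv t ⊎ x ∈fv u

  Closed : Term → Set
  Closed t = ∀ x → ¬ (x ∈fv t)

  data VContext : Set where
    hole : VContext
    appʳ : Term → VContext → VContext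
    appˡ : VContext → Term → VContext

  plugV : VContext → Term → Term
  plugV hole       s = s
  plugV (appʳ t V) s = app t (plugV V s)
  plugV (appˡ V t) s = app (plugV V s) t

  infix 4 _↦βv_ _→βv_

  data _↦βv_ : Rel Term 0ℓ where
    βv : ∀ t {v} → Value v → app (lam t) v ↦βv t [0:= v ]

  data _→βv_ : Rel Term 0ℓ where
    closure : ∀ V {t u} → t ↦βv u → plugV V t →βv plugV V u

  -- The named abstraction λx.t.
  abs : ℕ → Term → Term
  abs x t = lam (rename (bind x) t)

  -- General contexts bind by name, so that the same free variable of the
  -- plugged term can be captured by any binder above the hole.
  data Context : Set where
    hole : Context
    lam  : ℕ → Context → Context
    appˡ : Context → Term → Context
    appʳ : Term → Context → Context

  plug : Context → Term → Term
  plug hole       s = s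
  plug (lam x C)  s = abs x (plug C s)
  plug (appˡ C t) s = app (plug C s) t
  plug (appʳ t C) s = app t (plug C s)

module Silly where

  -- es t u is t[x\u]; it binds the index 0 in t and nothing in u.
  data Term : Set where
    var : ℕ → Term
    lam : Term → Term
    app : Term → Term → Term
    es  : Term → Term → Term

  data Value : Term → Set where
    lam : ∀ t → Value (lam t)

  rename : Ren → Term → Term
  rename ρ (var x)   = var (ρ x)
  rename ρ (lam t)   = lam (rename (ext ρ) t)
  rename ρ (app t u) = app (rename ρ t) (rename ρ u)
  rename ρ (es t u)  = es (rename (ext ρ) t) (rename ρ u)

  infix 4 _∈fv_
  _∈fv_ : ℕ → Term → Set
  x ∈fv var y   = x ≡ y
  x ∈fv lam t   = suc x ∈fv t
  x ∈fv app t u = x ∈fv t ⊎ x ∈fv u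
  x ∈fv es t u  = suc x ∈fv t ⊎ x ∈fv u

  Closed : Term → Set
  Closed t = ∀ x → ¬ (x ∈fv t)

  data SContext : Set where
    hole : SContext
    esˡ  : SContext → Term → SContext

  plugS : SContext → Term → Term
  plugS hole      s = s
  plugS (esˡ S u) s = es (plugS S s) u

  -- Number of binders above the hole.
  depthS : SContext → ℕ
  depthS hole      = 0
  depthS (esˡ S u) = suc (depthS S)

  data WContext : Set where
    hole : WContext
    appˡ : WContext → Term → WContext
    appʳ : Term → WContext → WContext
    esʳ  : Term → WContext → WContext
    esˡ  : WContext → Term → WContext

  plugW : WContext → Term → Term
  plugW hole       s = s
  plugW (appˡ W t) s = app (plugW W s) t
  plugW (appʳ t W) s = app t (plugW W s)
  plugW (esʳ t W)  s = es t (plugW W s)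
  plugW (esˡ W u)  s = es (plugW W s) u

  depthW : WContext → ℕ
  depthW hole       = 0
  depthW (appˡ W t) = depthW W
  depthW (appʳ t W) = depthW W
  depthW (esʳ t W)  = depthW W
  depthW (esˡ W u)  = suc (depthW W)

  -- W⟨⟨s⟩⟩: the free variables of s are shifted past the binders of W.
  plugW′ : WContext → Term → Term
  plugW′ W s = plugW W (rename (depthW W +_) s)

  infix 4 _↦m_ _↦e_ _↦gcv_ _→wm_ _→we_ _→wgcv_ _→w_

  -- The shifts below are the α-renamings that the named rules leave implicit:
  -- S never captures variables of u in the multiplicative rule nor of t in the
  -- GC rule, and in t[x\u] the variable x is not free in u.
  data _↦m_ : Rel Term 0ℓ where
    m : ∀ S t u →
        app (plugS S (lam t)) u ↦m plugS S (es t (rename (depthS S +_) u))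

  data _↦e_ : Rel Term 0ℓ where
    e : ∀ W u →
        es (plugW′ W (var 0)) u ↦e es (plugW′ W (rename suc u)) u

  -- rename pred lowers the indices of t, which no longer is under the binder
  -- of x; it is harmless at the index 0, which does not occur in t.
  data _↦gcv_ : Rel Term 0ℓ where
    gcv : ∀ t S {v} → Value v → ¬ (0 ∈fv t) →
          es t (plugS S v) ↦gcv plugS S (rename (depthS S +_) (rename pred t))

  data WeakClosure (R : Rel Term 0ℓ) : Rel Term 0ℓ where
    closure : ∀ W {t u} → R t u → WeakClosure R (plugW W t) (plugW W u)

  _→wm_ _→we_ _→wgcv_ _→w_ : Rel Term 0ℓ
  _→wm_   = WeakClosure _↦m_
  _→we_   = WeakClosure _↦e_
  _→wgcv_ = WeakClosure _↦gcv_
  _→w_    = _→wm_ ∪ _→we_ ∪ _→wgcv_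

  -- The named binders λx.t and t[x\u].
  abs : ℕ → Term → Term
  abs x t = lam (rename (bind x) t)

  sub : Term → ℕ → Term → Term
  sub t x u = es (rename (bind x) t) u

  -- Named binders, as for the contexts of the λ-calculus.
  data Context : Set where
    hole : Context
    lam  : ℕ → Context → Context
    appˡ : Context → Term → Context
    appʳ : Term → Context → Context
    subˡ : Context → ℕ → Term → Context
    subʳ : Term → ℕ → Context → Context

  plug : Context → Term → Term
  plug hole         s = s
  plug (lam x C)    s = abs x (plug C s)
  plug (appˡ C t)   s = app (plug C s) t
  plug (appʳ t C)   s = app t (plug C s)
  plug (subˡ C x u) s = sub (plug C s) x u
  plug (subʳ t x C) s = sub t x (plug C s)

Λ : Set
Λ = CbV.Term

⌜_⌝ : Λ → Silly.Term
⌜ CbV.var x ⌝   = Silly.var x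
⌜ CbV.lam t ⌝   = Silly.lam ⌜ t ⌝
⌜ CbV.app t u ⌝ = Silly.app ⌜ t ⌝ ⌜ u ⌝

infix 4 _≡S_ _≡V_

_≡S_ : Rel Silly.Term 0ℓ
_≡S_ = ContextualEquivalence Silly.plug Silly.Closed Silly._→w_

_≡V_ : Rel Λ 0ℓ
_≡V_ = ContextualEquivalence CbV.plug CbV.Closed CbV._→βv_

{-# OPTIONS --safe #-}
module Submission where

-- Translate an explicit substitution t[x\u] to the redex (λx.t)u, written t °.
-- For closed t, weak normalization of t and βv-normalization of t ° are both
-- equivalent to t ° having a value for big-step CbV evaluation:
-- * evaluation is invariant under weak expansion (both sides of each root rule
--   evaluate to the very same value under every substitution), and closed weak
--   normal forms are answers, that is, abstractions under explicit
--   substitutions of answers, which evaluate;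
-- * conversely an evaluation is simulated by the weak reductions that only
--   substitute answers; it ends on an answer, and the garbage collection of
--   answers terminates.
-- Both translations ° and ⌜_⌝ commute with plugging into contexts.

open import Defs
open import Data.Empty using (⊥-elim)
open import Data.Nat using (ℕ; zero; suc; pred; _+_; _≟_)
open import Data.Nat.Properties using (+-suc; +-comm; +-assoc; +-cancelˡ-≡; suc-injective)
open import Data.Product using (∃; _×_; _,_)
open import Data.Sum using (_⊎_; inj₁; inj₂)
open import Function using (_⇔_; _∘_; mk⇔; module Equivalence)
open import Function.Construct.Symmetry using (⇔-sym)
open import Function.Construct.Composition using (_⇔-∘_)
open import Relation.Binary.Construct.Closure.ReflexiveTransitive using (Star; ε; _◅_; _◅◅_; gmap; kleisliStar)
open import Relation.Binary.PropositionalEquality using (_≡_; refl; sym; trans; cong; cong₂; subst; subst₂)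
open import Relation.Binary.Rewriting using (IsNormalForm; HasNormalForm)
open import Relation.Nullary using (¬_; Dec; yes; no)
open import Relation.Nullary.Decidable using (_⊎-dec_)

module V = CbV
open Silly

-- Substitution calculus of λ-terms

ext-cong : ∀ {ρ ξ : Ren} → (∀ i → ρ i ≡ ξ i) → ∀ i → ext ρ i ≡ ext ξ i
ext-cong eq zero    = refl
ext-cong eq (suc i) = cong suc (eq i)

ext-∘ : ∀ (ρ ξ : Ren) i → ext ρ (ext ξ i) ≡ ext (ρ ∘ ξ) i
ext-∘ ρ ξ zero    = refl
ext-∘ ρ ξ (suc i) = refl

ext-id : ∀ i → ext (λ j → j) i ≡ i
ext-id zero    = refl
ext-id (suc i) = refl

Sub : Set
Sub = ℕ → Λ

infixr 6 _•_
_•_ : Λ → Sub → Sub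
(u • σ) zero    = u
(u • σ) (suc i) = σ i

V-rename-cong : ∀ {ρ ξ} → (∀ i → ρ i ≡ ξ i) → ∀ t → V.rename ρ t ≡ V.rename ξ t
V-rename-cong eq (V.var x)   = cong V.var (eq x)
V-rename-cong eq (V.lam t)   = cong V.lam (V-rename-cong (ext-cong eq) t)
V-rename-cong eq (V.app t u) = cong₂ V.app (V-rename-cong eq t) (V-rename-cong eq u)

V-rename-∘ : ∀ ρ ξ t → V.rename ρ (V.rename ξ t) ≡ V.rename (ρ ∘ ξ) t
V-rename-∘ ρ ξ (V.var x)   = refl
V-rename-∘ ρ ξ (V.lam t)   =
  cong V.lam (trans (V-rename-∘ (ext ρ) (ext ξ) t) (V-rename-cong (ext-∘ ρ ξ) t))
V-rename-∘ ρ ξ (V.app t u) = cong₂ V.app (V-rename-∘ ρ ξ t) (V-rename-∘ ρ ξ u)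

-- Agreement is asked at free variables only, so that garbage collection may compare substitutions
-- that differ at the erased variable.
subst-cong-fv : ∀ {σ τ} t → (∀ i → i V.∈fv t → σ i ≡ τ i) → V.subst σ t ≡ V.subst τ t
subst-cong-fv (V.var x)   eq = eq x refl
subst-cong-fv {σ} {τ} (V.lam t) eq = cong V.lam (subst-cong-fv t exts-eq)
  where
  exts-eq : ∀ i → i V.∈fv t → V.exts σ i ≡ V.exts τ i
  exts-eq zero    _   = refl
  exts-eq (suc i) i∈t = cong (V.rename suc) (eq i i∈t)
subst-cong-fv (V.app t u) eq =
  cong₂ V.app (subst-cong-fv t (λ i → eq i ∘ inj₁)) (subst-cong-fv u (λ i → eq i ∘ inj₂))

subst-cong : ∀ {σ τ} → (∀ i → σ i ≡ τ i) → ∀ t → V.subst σ t ≡ V.subst τ t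
subst-cong eq t = subst-cong-fv t (λ i _ → eq i)

subst-rename : ∀ σ ρ t → V.subst σ (V.rename ρ t) ≡ V.subst (σ ∘ ρ) t
subst-rename σ ρ (V.var x)   = refl
subst-rename σ ρ (V.lam t)   =
  cong V.lam (trans (subst-rename (V.exts σ) (ext ρ) t) (subst-cong exts-ext t))
  where
  exts-ext : ∀ i → V.exts σ (ext ρ i) ≡ V.exts (σ ∘ ρ) i
  exts-ext zero    = refl
  exts-ext (suc i) = refl
subst-rename σ ρ (V.app t u) = cong₂ V.app (subst-rename σ ρ t) (subst-rename σ ρ u)

rename-subst : ∀ ρ σ t → V.rename ρ (V.subst σ t) ≡ V.subst (V.rename ρ ∘ σ) t
rename-subst ρ σ (V.var x)   = refl
rename-subst ρ σ (V.lam t)   =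
  cong V.lam (trans (rename-subst (ext ρ) (V.exts σ) t) (subst-cong ext-exts t))
  where
  ext-exts : ∀ i → V.rename (ext ρ) (V.exts σ i) ≡ V.exts (V.rename ρ ∘ σ) i
  ext-exts zero    = refl
  ext-exts (suc i) =
    trans (V-rename-∘ (ext ρ) suc (σ i)) (sym (V-rename-∘ suc ρ (σ i)))
rename-subst ρ σ (V.app t u) = cong₂ V.app (rename-subst ρ σ t) (rename-subst ρ σ u)

subst-∘ : ∀ σ τ t → V.subst σ (V.subst τ t) ≡ V.subst (V.subst σ ∘ τ) t
subst-∘ σ τ (V.var x)   = refl
subst-∘ σ τ (V.lam t)   =
  cong V.lam (trans (subst-∘ (V.exts σ) (V.exts τ) t) (subst-cong exts-∘ t))
  where
  exts-∘ : ∀ i → V.subst (V.exts σ) (V.exts τ i) ≡ V.exts (V.subst σ ∘ τ) i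
  exts-∘ zero    = refl
  exts-∘ (suc i) =
    trans (subst-rename (V.exts σ) suc (τ i)) (sym (rename-subst suc σ (τ i)))
subst-∘ σ τ (V.app t u) = cong₂ V.app (subst-∘ σ τ t) (subst-∘ σ τ u)

subst-var : ∀ t → V.subst V.var t ≡ t
subst-var (V.var x)   = refl
subst-var (V.lam t)   = cong V.lam (trans (subst-cong exts-var t) (subst-var t))
  where
  exts-var : ∀ i → V.exts V.var i ≡ V.var i
  exts-var zero    = refl
  exts-var (suc i) = refl
subst-var (V.app t u) = cong₂ V.app (subst-var t) (subst-var u)

-- Firing the β-redex that translates an explicit substitution amounts to extending the ambient
-- substitution by the value `w`: the weakening done by `V.exts` is undone by `w • V.var`.
subst-•-exts : ∀ w σ t → V.subst (w • V.var) (V.subst (V.exts σ) t) ≡ V.subst (w • σ) t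
subst-•-exts w σ t = trans (subst-∘ (w • V.var) (V.exts σ) t) (subst-cong pointwise t)
  where
  pointwise : ∀ i → V.subst (w • V.var) (V.exts σ i) ≡ (w • σ) i
  pointwise zero    = refl
  pointwise (suc i) = trans (subst-rename (w • V.var) suc (σ i)) (subst-var (σ i))

[0:=]-• : ∀ t w → t V.[0:= w ] ≡ V.subst (w • V.var) t
[0:=]-• t w = subst-cong (λ { zero → refl ; (suc i) → refl }) t

V-∈fv-rename⁻ : ∀ ρ t {x} → x V.∈fv V.rename ρ t → ∃ λ y → y V.∈fv t × x ≡ ρ y
V-∈fv-rename⁻ ρ (V.var y)   refl = y , refl , refl
V-∈fv-rename⁻ ρ (V.lam t)   p with V-∈fv-rename⁻ (ext ρ) t p
... | suc y , q , refl = y , q , refl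
V-∈fv-rename⁻ ρ (V.app t u) (inj₁ p) with V-∈fv-rename⁻ ρ t p
... | y , q , eq = y , inj₁ q , eq
V-∈fv-rename⁻ ρ (V.app t u) (inj₂ p) with V-∈fv-rename⁻ ρ u p
... | y , q , eq = y , inj₂ q , eq

∈fv-subst⁻ : ∀ σ t {x} → x V.∈fv V.subst σ t → ∃ λ y → y V.∈fv t × x V.∈fv σ y
∈fv-subst⁻ σ (V.var y)   p = y , refl , p
∈fv-subst⁻ σ (V.lam t)   p with ∈fv-subst⁻ (V.exts σ) t p
... | suc y , q , r with V-∈fv-rename⁻ suc (σ y) r
...   | _ , r′ , refl = y , q , r′
∈fv-subst⁻ σ (V.app t u) (inj₁ p) with ∈fv-subst⁻ σ t p
... | y , q , r = y , inj₁ q , r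
∈fv-subst⁻ σ (V.app t u) (inj₂ p) with ∈fv-subst⁻ σ u p
... | y , q , r = y , inj₂ q , r

-- Call-by-value evaluation

infix 4 _⇓_
data _⇓_ : Λ → Λ → Set where
  lam : ∀ {t} → V.lam t ⇓ V.lam t
  app : ∀ {t u b w v} → t ⇓ V.lam b → u ⇓ w → V.subst (w • V.var) b ⇓ v → V.app t u ⇓ v

⇓-value : ∀ {t v} → t ⇓ v → V.Value v
⇓-value lam         = V.lam _
⇓-value (app _ _ p) = ⇓-value p

value-⇓ : ∀ {v} → V.Value v → v ⇓ v
value-⇓ (V.lam _) = lam

⇓-deterministic : ∀ {t v w} → t ⇓ v → t ⇓ w → v ≡ w
⇓-deterministic lam lam = refl
⇓-deterministic (app p q r) (app p′ q′ r′)
  with ⇓-deterministic p p′ | ⇓-deterministic q q′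
... | refl | refl = ⇓-deterministic r r′

βv-root : ∀ {t u} → t V.↦βv u → t V.→βv u
βv-root = V.closure V.hole

βv-appˡ : ∀ {t t′} u → t V.→βv t′ → V.app t u V.→βv V.app t′ u
βv-appˡ u (V.closure W r) = V.closure (V.appˡ W u) r

βv-appʳ : ∀ t {u u′} → u V.→βv u′ → V.app t u V.→βv V.app t u′
βv-appʳ t (V.closure W r) = V.closure (V.appʳ t W) r

⇓⇒→βv* : ∀ {t v} → t ⇓ v → Star V._→βv_ t v
⇓⇒→βv* lam = ε
⇓⇒→βv* (app {u = u} {b} {w} p q r) =
  gmap (λ s → V.app s u) (βv-appˡ u) (⇓⇒→βv* p) ◅◅
  gmap (V.app (V.lam b)) (βv-appʳ (V.lam b)) (⇓⇒→βv* q) ◅◅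
  subst (V._→βv_ _) ([0:=]-• b w) (βv-root (V.βv b (⇓-value q))) ◅
  ⇓⇒→βv* r

-- At the root, the value argument evaluates to itself, which supplies the missing premise of `app`;
-- deeper steps lie inside one of the first two premises.
→βv-⇓ : ∀ {t u v} → t V.→βv u → u ⇓ v → t ⇓ v
→βv-⇓ (V.closure V.hole (V.βv t {w} val)) p =
  app lam (value-⇓ val) (subst (_⇓ _) ([0:=]-• t w) p)
→βv-⇓ (V.closure (V.appʳ t W) r) (app p q s) = app p (→βv-⇓ (V.closure W r) q) s
→βv-⇓ (V.closure (V.appˡ W t) r) (app p q s) = app (→βv-⇓ (V.closure W r) p) q s

→βv-∈fv : ∀ {t u x} → t V.→βv u → x V.∈fv u → x V.∈fv t
→βv-∈fv (V.closure V.hole (V.βv t {w} _)) p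
  with ∈fv-subst⁻ (w • V.var) t (subst (_ V.∈fv_) ([0:=]-• t w) p)
... | zero  , _ , r    = inj₂ r
... | suc y , q , refl = inj₁ q
→βv-∈fv (V.closure (V.appʳ t W) r) (inj₁ p) = inj₁ p
→βv-∈fv (V.closure (V.appʳ t W) r) (inj₂ p) = inj₂ (→βv-∈fv (V.closure W r) p)
→βv-∈fv (V.closure (V.appˡ W t) r) (inj₁ p) = inj₁ (→βv-∈fv (V.closure W r) p)
→βv-∈fv (V.closure (V.appˡ W t) r) (inj₂ p) = inj₂ p

V-closed-normal⇒value : ∀ t → V.Closed t → IsNormalForm V._→βv_ t → V.Value t
V-closed-normal⇒value (V.var x)   cl nf = ⊥-elim (cl x refl)
V-closed-normal⇒value (V.lam t)   cl nf = V.lam t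
V-closed-normal⇒value (V.app t u) cl nf
  with V-closed-normal⇒value t (λ x → cl x ∘ inj₁) (λ (_ , r) → nf (_ , βv-appˡ u r))
     | V-closed-normal⇒value u (λ x → cl x ∘ inj₂) (λ (_ , r) → nf (_ , βv-appʳ t r))
... | V.lam b | val = ⊥-elim (nf (_ , βv-root (V.βv b val)))

⇓⇒V-normalizing : ∀ {t v} → t ⇓ v → HasNormalForm V._→βv_ t
⇓⇒V-normalizing p = _ , value-normal (⇓-value p) , ⇓⇒→βv* p
  where
  value-normal : ∀ {v} → V.Value v → IsNormalForm V._→βv_ v
  value-normal (V.lam _) (_ , r) = lam-irreducible r refl
    where
    lam-irreducible : ∀ {s s′ b} → s V.→βv s′ → ¬ (s ≡ V.lam b)
    lam-irreducible (V.closure V.hole (V.βv _ _)) ()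
    lam-irreducible (V.closure (V.appʳ _ _) _) ()
    lam-irreducible (V.closure (V.appˡ _ _) _) ()

V-normalizing⇒⇓ : ∀ {t} → V.Closed t → HasNormalForm V._→βv_ t → ∃ (t ⇓_)
V-normalizing⇒⇓ cl (n , nf , ε) = n , value-⇓ (V-closed-normal⇒value n cl nf)
V-normalizing⇒⇓ cl (n , nf , r ◅ rs)
  with V-normalizing⇒⇓ (λ x → cl x ∘ →βv-∈fv r) (n , nf , rs)
... | v , p = v , →βv-⇓ r p

-- Explicit substitutions as β-redexes

infix 9 _°
_° : Term → Λ
var x °   = V.var x
lam t °   = V.lam (t °)
app t u ° = V.app (t °) (u °)
es t u °  = V.app (V.lam (t °)) (u °)

°-rename : ∀ ρ t → rename ρ t ° ≡ V.rename ρ (t °)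
°-rename ρ (var x)   = refl
°-rename ρ (lam t)   = cong V.lam (°-rename (ext ρ) t)
°-rename ρ (app t u) = cong₂ V.app (°-rename ρ t) (°-rename ρ u)
°-rename ρ (es t u)  = cong₂ (V.app ∘ V.lam) (°-rename (ext ρ) t) (°-rename ρ u)

∈fv⇒∈fv° : ∀ t {x} → x ∈fv t → x V.∈fv t °
∈fv⇒∈fv° (var y)   p        = p
∈fv⇒∈fv° (lam t)   p        = ∈fv⇒∈fv° t p
∈fv⇒∈fv° (app t u) (inj₁ p) = inj₁ (∈fv⇒∈fv° t p)
∈fv⇒∈fv° (app t u) (inj₂ p) = inj₂ (∈fv⇒∈fv° u p)
∈fv⇒∈fv° (es t u)  (inj₁ p) = inj₁ (∈fv⇒∈fv° t p)
∈fv⇒∈fv° (es t u)  (inj₂ p) = inj₂ (∈fv⇒∈fv° u p)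

∈fv°⇒∈fv : ∀ t {x} → x V.∈fv t ° → x ∈fv t
∈fv°⇒∈fv (var y)   p        = p
∈fv°⇒∈fv (lam t)   p        = ∈fv°⇒∈fv t p
∈fv°⇒∈fv (app t u) (inj₁ p) = inj₁ (∈fv°⇒∈fv t p)
∈fv°⇒∈fv (app t u) (inj₂ p) = inj₂ (∈fv°⇒∈fv u p)
∈fv°⇒∈fv (es t u)  (inj₁ p) = inj₁ (∈fv°⇒∈fv t p)
∈fv°⇒∈fv (es t u)  (inj₂ p) = inj₂ (∈fv°⇒∈fv u p)

infix 9 _⟦_⟧
-- Weak contexts enter the body of an explicit substitution. The substitution `σ` holds the values
-- of the enclosing ones, which makes statements about evaluation inductive.
_⟦_⟧ : Term → Sub → Λ
t ⟦ σ ⟧ = V.subst σ (t °)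

⟦⟧-cong : ∀ {σ τ} t → (∀ i → σ i ≡ τ i) → t ⟦ σ ⟧ ≡ t ⟦ τ ⟧
⟦⟧-cong t eq = subst-cong eq (t °)

⟦⟧-rename : ∀ ρ t σ → rename ρ t ⟦ σ ⟧ ≡ t ⟦ σ ∘ ρ ⟧
⟦⟧-rename ρ t σ = trans (cong (V.subst σ) (°-rename ρ t)) (subst-rename σ ρ (t °))

-- The first `d` entries of `τ` are left free: they are the values of the explicit substitutions
-- crossed on the way to the hole of a context of depth `d`.
Extends : ℕ → Sub → Sub → Set
Extends d τ σ = ∀ i → τ (d + i) ≡ σ i

⟦⟧-shift : ∀ d {τ σ} t → Extends d τ σ → rename (d +_) t ⟦ τ ⟧ ≡ t ⟦ σ ⟧
⟦⟧-shift d t ext = trans (⟦⟧-rename (d +_) t _) (⟦⟧-cong t ext)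

Extends-suc : ∀ d τ {w σ} → Extends d τ (w • σ) → Extends (suc d) τ σ
Extends-suc d τ ext i = trans (cong τ (sym (+-suc d i))) (ext (suc i))

es-⇓ : ∀ {t u σ w v} → u ⟦ σ ⟧ ⇓ w → t ⟦ w • σ ⟧ ⇓ v → es t u ⟦ σ ⟧ ⇓ v
es-⇓ {t} {σ = σ} {w} p q = app lam p (subst (_⇓ _) (sym (subst-•-exts w σ (t °))) q)

es-⇓⁻ : ∀ {t u σ v} → es t u ⟦ σ ⟧ ⇓ v → ∃ λ w → u ⟦ σ ⟧ ⇓ w × t ⟦ w • σ ⟧ ⇓ v
es-⇓⁻ {t} {σ = σ} (app {w = w} lam p q) = w , p , subst (_⇓ _) (subst-•-exts w σ (t °)) q

-- Evaluation and weak reduction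

-- The hole is never under an abstraction, so evaluating the whole term evaluates the hole under
-- some `τ` extending `σ`; that subderivation can be replaced by one with the same result.
plugW-⇓ : ∀ W {t u σ v} →
  (∀ {τ v} → Extends (depthW W) τ σ → t ⟦ τ ⟧ ⇓ v → u ⟦ τ ⟧ ⇓ v) →
  plugW W t ⟦ σ ⟧ ⇓ v → plugW W u ⟦ σ ⟧ ⇓ v
plugW-⇓ hole       h p           = h (λ _ → refl) p
plugW-⇓ (appˡ W s) h (app p q r) = app (plugW-⇓ W h p) q r
plugW-⇓ (appʳ s W) h (app p q r) = app p (plugW-⇓ W h q) r
plugW-⇓ (esʳ s W)  h (app p q r) = app p (plugW-⇓ W h q) r
plugW-⇓ (esˡ W s) {t} {u} h p with es-⇓⁻ {plugW W t} {s} p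
... | w , q , r =
  es-⇓ {plugW W u} {s} q (plugW-⇓ W (λ {τ} ext → h (Extends-suc (depthW W) τ ext)) r)

-- Here `τ` adds to `σ` the values of the substitutions in `S`. The last component reuses their
-- evaluations around any other term in the hole, possibly with another result.
plugS-⇓⁻ : ∀ S {t σ v} → plugS S t ⟦ σ ⟧ ⇓ v →
  ∃ λ τ → Extends (depthS S) τ σ × t ⟦ τ ⟧ ⇓ v ×
          (∀ u {v} → u ⟦ τ ⟧ ⇓ v → plugS S u ⟦ σ ⟧ ⇓ v)
plugS-⇓⁻ hole {σ = σ} p = σ , (λ _ → refl) , p , λ _ q → q
plugS-⇓⁻ (esˡ S s) {t} p with es-⇓⁻ {plugS S t} {s} p
... | w , q , r with plugS-⇓⁻ S {t} r
...   | τ , ext , r′ , back =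
  τ , Extends-suc (depthS S) τ ext , r′ , λ u r″ → es-⇓ {plugS S u} {s} q (back u r″)

m-⇓ : ∀ {t u σ v} → t ↦m u → u ⟦ σ ⟧ ⇓ v → t ⟦ σ ⟧ ⇓ v
m-⇓ (m S t u) p with plugS-⇓⁻ S p
... | τ , ext , app lam q r , back =
  app (back (lam t) lam) (subst (_⇓ _) (⟦⟧-shift (depthS S) u ext) q) r

-- The substituted variable denotes the value `w` of `u`. The copy of `u` in the hole evaluates to
-- the same `w` by determinism, hence so does the variable.
e-⇓ : ∀ {t u σ v} → t ↦e u → u ⟦ σ ⟧ ⇓ v → t ⟦ σ ⟧ ⇓ v
e-⇓ {σ = σ} (e W u) p with es-⇓⁻ {plugW′ W (rename suc u)} {u} p
... | w , q , r = es-⇓ {plugW′ W (var 0)} {u} q (plugW-⇓ W replace r)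
  where
  replace : ∀ {τ v} → Extends (depthW W) τ (w • σ) →
            rename (depthW W +_) (rename suc u) ⟦ τ ⟧ ⇓ v → var (depthW W + 0) ⟦ τ ⟧ ⇓ v
  replace ext s = subst (_⇓ _) (sym (ext 0)) (subst (w ⇓_) w≡v (value-⇓ (⇓-value q)))
    where
    shift : rename (depthW W +_) (rename suc u) ⟦ _ ⟧ ≡ u ⟦ σ ⟧
    shift = trans (⟦⟧-shift (depthW W) (rename suc u) ext) (⟦⟧-rename suc u (w • σ))
    w≡v = ⇓-deterministic q (subst (_⇓ _) shift s)

-- Call-by-value must still evaluate the erased argument. It can: the reduct already evaluates the
-- substitutions of `S`, and what they surround is an abstraction.
gcv-⇓ : ∀ {t u σ v} → t ↦gcv u → u ⟦ σ ⟧ ⇓ v → t ⟦ σ ⟧ ⇓ v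
gcv-⇓ {σ = σ} (gcv t S {v} (lam b) 0∉t) p with plugS-⇓⁻ S p
... | τ , ext , q , back =
  es-⇓ {t} {plugS S v} (back (lam b) lam) (subst (_⇓ _) unused q)
  where
  agree : ∀ {w} i → i V.∈fv t ° → σ (pred i) ≡ (w • σ) i
  agree zero    0∈t = ⊥-elim (0∉t (∈fv°⇒∈fv t 0∈t))
  agree (suc i) _   = refl
  unused : ∀ {w} → rename (depthS S +_) (rename pred t) ⟦ τ ⟧ ≡ t ⟦ w • σ ⟧
  unused = trans (⟦⟧-shift (depthS S) (rename pred t) ext)
                 (trans (⟦⟧-rename pred t σ) (subst-cong-fv (t °) agree))

→w-⇓ : ∀ {t u σ v} → t →w u → u ⟦ σ ⟧ ⇓ v → t ⟦ σ ⟧ ⇓ v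
→w-⇓ (inj₁ (closure W r))        = plugW-⇓ W (λ _ → m-⇓ r)
→w-⇓ (inj₂ (inj₁ (closure W r))) = plugW-⇓ W (λ _ → e-⇓ r)
→w-⇓ (inj₂ (inj₂ (closure W r))) = plugW-⇓ W (λ _ → gcv-⇓ r)

-- Free variables along weak reduction

∈fv-rename⁻ : ∀ ρ t {x} → x ∈fv rename ρ t → ∃ λ y → y ∈fv t × x ≡ ρ y
∈fv-rename⁻ ρ t p
  with V-∈fv-rename⁻ ρ (t °) (subst (_ V.∈fv_) (°-rename ρ t) (∈fv⇒∈fv° (rename ρ t) p))
... | y , q , eq = y , ∈fv°⇒∈fv t q , eq

∈fv-shift⁻ : ∀ d t {x} → d + x ∈fv rename (d +_) t → x ∈fv t
∈fv-shift⁻ d t p with ∈fv-rename⁻ (d +_) t p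
... | y , q , eq = subst (_∈fv t) (sym (+-cancelˡ-≡ d _ _ eq)) q

-- The left alternative is an occurrence in `W` itself, which therefore survives any change of the
-- term in the hole.
∈fv-plugW⁻ : ∀ W {t x} → x ∈fv plugW W t → (∀ u → x ∈fv plugW W u) ⊎ depthW W + x ∈fv t
∈fv-plugW⁻ hole       p        = inj₂ p
∈fv-plugW⁻ (appˡ W s) (inj₂ p) = inj₁ (λ _ → inj₂ p)
∈fv-plugW⁻ (appˡ W s) (inj₁ p) with ∈fv-plugW⁻ W p
... | inj₁ q = inj₁ (inj₁ ∘ q)
... | inj₂ q = inj₂ q
∈fv-plugW⁻ (appʳ s W) (inj₁ p) = inj₁ (λ _ → inj₁ p)
∈fv-plugW⁻ (appʳ s W) (inj₂ p) with ∈fv-plugW⁻ W p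
... | inj₁ q = inj₁ (inj₂ ∘ q)
... | inj₂ q = inj₂ q
∈fv-plugW⁻ (esʳ s W)  (inj₁ p) = inj₁ (λ _ → inj₁ p)
∈fv-plugW⁻ (esʳ s W)  (inj₂ p) with ∈fv-plugW⁻ W p
... | inj₁ q = inj₁ (inj₂ ∘ q)
... | inj₂ q = inj₂ q
∈fv-plugW⁻ (esˡ W s)  (inj₂ p) = inj₁ (λ _ → inj₂ p)
∈fv-plugW⁻ (esˡ W s) {t} (inj₁ p) with ∈fv-plugW⁻ W p
... | inj₁ q = inj₁ (inj₁ ∘ q)
... | inj₂ q = inj₂ (subst (_∈fv t) (+-suc (depthW W) _) q)

∈fv-plugW : ∀ W {t x} → depthW W + x ∈fv t → x ∈fv plugW W t
∈fv-plugW hole       p = p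
∈fv-plugW (appˡ W s) p = inj₁ (∈fv-plugW W p)
∈fv-plugW (appʳ s W) p = inj₂ (∈fv-plugW W p)
∈fv-plugW (esʳ s W)  p = inj₂ (∈fv-plugW W p)
∈fv-plugW (esˡ W s) {t} p = inj₁ (∈fv-plugW W (subst (_∈fv t) (sym (+-suc (depthW W) _)) p))

∈fv-plugS⁻ : ∀ S {t x} → x ∈fv plugS S t → (∀ u → x ∈fv plugS S u) ⊎ depthS S + x ∈fv t
∈fv-plugS⁻ hole      p        = inj₂ p
∈fv-plugS⁻ (esˡ S s) (inj₂ p) = inj₁ (λ _ → inj₂ p)
∈fv-plugS⁻ (esˡ S s) {t} (inj₁ p) with ∈fv-plugS⁻ S p
... | inj₁ q = inj₁ (inj₁ ∘ q)
... | inj₂ q = inj₂ (subst (_∈fv t) (+-suc (depthS S) _) q)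

∈fv-plugS : ∀ S {t x} → depthS S + x ∈fv t → x ∈fv plugS S t
∈fv-plugS hole      p = p
∈fv-plugS (esˡ S s) {t} p = inj₁ (∈fv-plugS S (subst (_∈fv t) (sym (+-suc (depthS S) _)) p))

m-∈fv : ∀ {t u x} → t ↦m u → x ∈fv u → x ∈fv t
m-∈fv (m S t u) p with ∈fv-plugS⁻ S p
... | inj₁ q        = inj₁ (q (lam t))
... | inj₂ (inj₁ q) = inj₁ (∈fv-plugS S q)
... | inj₂ (inj₂ q) = inj₂ (∈fv-shift⁻ (depthS S) u q)

e-∈fv : ∀ {t u x} → t ↦e u → x ∈fv u → x ∈fv t
e-∈fv (e W u) (inj₂ p) = inj₂ p
e-∈fv (e W u) (inj₁ p) with ∈fv-plugW⁻ W p
... | inj₁ q = inj₁ (q _)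
... | inj₂ q with ∈fv-rename⁻ suc u (∈fv-shift⁻ (depthW W) (rename suc u) q)
...   | _ , r , refl = inj₂ r

gcv-∈fv : ∀ {t u x} → t ↦gcv u → x ∈fv u → x ∈fv t
gcv-∈fv (gcv t S {v} _ 0∉t) p with ∈fv-plugS⁻ S p
... | inj₁ q = inj₂ (q v)
... | inj₂ q with ∈fv-rename⁻ pred t (∈fv-shift⁻ (depthS S) (rename pred t) q)
...   | zero  , r , _    = ⊥-elim (0∉t r)
...   | suc y , r , refl = inj₁ r

WeakClosure-∈fv : ∀ {R} → (∀ {t u x} → R t u → x ∈fv u → x ∈fv t) →
  ∀ {t u x} → WeakClosure R t u → x ∈fv u → x ∈fv t
WeakClosure-∈fv h (closure W r) p with ∈fv-plugW⁻ W p
... | inj₁ q = q _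
... | inj₂ q = ∈fv-plugW W (h r q)

→w-∈fv : ∀ {t u x} → t →w u → x ∈fv u → x ∈fv t
→w-∈fv (inj₁ r)        = WeakClosure-∈fv m-∈fv r
→w-∈fv (inj₂ (inj₁ r)) = WeakClosure-∈fv e-∈fv r
→w-∈fv (inj₂ (inj₂ r)) = WeakClosure-∈fv gcv-∈fv r

-- Answers

data Answer : Term → Set where
  lam : ∀ t → Answer (lam t)
  es  : ∀ {t u} → Answer t → Answer u → Answer (es t u)

answer-rename : ∀ {t} ρ → Answer t → Answer (rename ρ t)
answer-rename ρ (lam t)  = lam (rename (ext ρ) t)
answer-rename ρ (es a b) = es (answer-rename (ext ρ) a) (answer-rename ρ b)

answer-⇓ : ∀ {t} σ → Answer t → ∃ (t ⟦ σ ⟧ ⇓_)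
answer-⇓ σ (lam t) = _ , lam
answer-⇓ σ (es {t} {u} a b) with answer-⇓ σ b
... | w , p with answer-⇓ (w • σ) a
...   | v , q = v , es-⇓ {t} {u} p q

answer-plugW⁻ : ∀ W {t} → Answer (plugW W t) → Answer t
answer-plugW⁻ hole      a        = a
answer-plugW⁻ (esʳ _ W) (es _ b) = answer-plugW⁻ W b
answer-plugW⁻ (esˡ W _) (es a _) = answer-plugW⁻ W a

-- On answers, this counts the substitutions that weak reduction can reach; those under an
-- abstraction count for nothing.
#es : Term → ℕ
#es (es t u) = suc (#es t + #es u)
#es _        = 0

#es-rename : ∀ {t} ρ → Answer t → #es (rename ρ t) ≡ #es t
#es-rename ρ (lam t)  = refl
#es-rename ρ (es a b) = cong suc (cong₂ _+_ (#es-rename (ext ρ) a) (#es-rename ρ b))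

-- The fields `refill` and `size` serve the collection of `es t a`: moving `t` into `S` yields an
-- answer again, with one substitution fewer.
record AnswerView (a : Term) : Set where
  constructor view
  field
    S      : SContext
    body   : Term
    shape  : a ≡ plugS S (lam body)
    refill : ∀ {t} → Answer t → Answer (plugS S t)
    size   : ∀ t → #es (plugS S t) ≡ #es t + #es a

answer-view : ∀ {a} → Answer a → AnswerView a
answer-view (lam t) = view hole t refl (λ a → a) (λ t → +-comm 0 (#es t))
answer-view (es {t} {u} a b) with answer-view a
... | view S body shape refill size =
  view (esˡ S u) body (cong (λ s → es s u) shape) (λ c → es (refill c) b)
       (λ s → trans (cong (λ n → suc (n + #es u)) (size s))
         (trans (cong suc (+-assoc (#es s) _ _)) (sym (+-suc (#es s) _))))

w-cong : (f : WContext → WContext) (g : Term → Term) → (∀ W t → plugW (f W) t ≡ g (plugW W t)) →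
  ∀ {t u} → t →w u → g t →w g u
w-cong f g eq (inj₁ (closure W r)) =
  subst₂ _→w_ (eq W _) (eq W _) (inj₁ (closure (f W) r))
w-cong f g eq (inj₂ (inj₁ (closure W r))) =
  subst₂ _→w_ (eq W _) (eq W _) (inj₂ (inj₁ (closure (f W) r)))
w-cong f g eq (inj₂ (inj₂ (closure W r))) =
  subst₂ _→w_ (eq W _) (eq W _) (inj₂ (inj₂ (closure (f W) r)))

w-appˡ : ∀ {t t′} u → t →w t′ → app t u →w app t′ u
w-appˡ u = w-cong (λ W → appˡ W u) (λ t → app t u) (λ _ _ → refl)

w-appʳ : ∀ t {u u′} → u →w u′ → app t u →w app t u′
w-appʳ t = w-cong (appʳ t) (app t) (λ _ _ → refl)

w-esˡ : ∀ {t t′} u → t →w t′ → es t u →w es t′ u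
w-esˡ u = w-cong (λ W → esˡ W u) (λ t → es t u) (λ _ _ → refl)

w-esʳ : ∀ t {u u′} → u →w u′ → es t u →w es t u′
w-esʳ t = w-cong (esʳ t) (es t) (λ _ _ → refl)

m-step : ∀ {t u} → t ↦m u → t →w u
m-step r = inj₁ (closure hole r)

e-step : ∀ {t u} → t ↦e u → t →w u
e-step r = inj₂ (inj₁ (closure hole r))

gcv-step : ∀ {t u} → t ↦gcv u → t →w u
gcv-step r = inj₂ (inj₂ (closure hole r))

-- Normal forms

-- Closedness is lost in the body of an explicit substitution. The absence of free variables in weak
-- position is inherited instead, because normality excludes the newly bound one.
weak-var-free-normal⇒answer : ∀ t → (∀ W i → ¬ (t ≡ plugW′ W (var i))) →
  IsNormalForm _→w_ t → Answer t
weak-var-free-normal⇒answer (var x) wvf nf = ⊥-elim (wvf hole x refl)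
weak-var-free-normal⇒answer (lam t) wvf nf = lam t
weak-var-free-normal⇒answer (app t u) wvf nf
  with answer-view (weak-var-free-normal⇒answer t
         (λ W i eq → wvf (appˡ W u) i (cong (λ s → app s u) eq))
         (λ (_ , r) → nf (_ , w-appˡ u r)))
... | view S body refl _ _ = ⊥-elim (nf (_ , m-step (m S body u)))
weak-var-free-normal⇒answer (es t u) wvf nf =
  es (weak-var-free-normal⇒answer t wvf-t (λ (_ , r) → nf (_ , w-esˡ u r)))
     (weak-var-free-normal⇒answer u
       (λ W i eq → wvf (esʳ t W) i (cong (es t) eq))
       (λ (_ , r) → nf (_ , w-esʳ t r)))
  where
  wvf-t : ∀ W i → ¬ (t ≡ plugW′ W (var i))
  -- Index 0 in weak position would be an exponential redex; any other index would be a weak free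
  -- variable of the whole term.
  wvf-t W zero    refl = nf (_ , e-step (e W u))
  wvf-t W (suc i) eq   = wvf (esˡ W u) i
    (cong (λ s → es s u) (trans eq (cong (plugW W ∘ var) (+-suc (depthW W) i))))

closed-normal⇒answer : ∀ t → Closed t → IsNormalForm _→w_ t → Answer t
closed-normal⇒answer t cl = weak-var-free-normal⇒answer t wvf
  where
  wvf : ∀ W i → ¬ (t ≡ plugW′ W (var i))
  wvf W i refl = cl i (∈fv-plugW W refl)

w-normalizing⇒⇓ : ∀ {t} → Closed t → HasNormalForm _→w_ t → ∃ (t ⟦ V.var ⟧ ⇓_)
w-normalizing⇒⇓ cl (n , nf , ε) = answer-⇓ V.var (closed-normal⇒answer n cl nf)
w-normalizing⇒⇓ {t} cl (n , nf , _◅_ {j = u} r rs)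
  with w-normalizing⇒⇓ (λ x → cl x ∘ →w-∈fv r) (n , nf , rs)
... | v , p = v , →w-⇓ {t} {u} r p

data NormalAnswer : Term → Set where
  lam : ∀ t → NormalAnswer (lam t)
  es  : ∀ {t u} → NormalAnswer t → NormalAnswer u → 0 ∈fv t → NormalAnswer (es t u)

normalAnswer⇒answer : ∀ {t} → NormalAnswer t → Answer t
normalAnswer⇒answer (lam t)    = lam t
normalAnswer⇒answer (es a b _) = es (normalAnswer⇒answer a) (normalAnswer⇒answer b)

normalAnswer-plugW⁻ : ∀ W {t} → NormalAnswer (plugW W t) → NormalAnswer t
normalAnswer-plugW⁻ hole      a          = a
normalAnswer-plugW⁻ (esʳ _ W) (es _ b _) = normalAnswer-plugW⁻ W b
normalAnswer-plugW⁻ (esˡ W _) (es a _ _) = normalAnswer-plugW⁻ W a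

-- Answers have neither applications nor variables in weak position, which excludes the
-- multiplicative and exponential rules; `0 ∈fv t` excludes garbage collection.
normalAnswer⇒normal : ∀ {t} → NormalAnswer t → IsNormalForm _→w_ t
normalAnswer⇒normal a (_ , inj₁ (closure W (m S t u))) with normalAnswer-plugW⁻ W a
... | ()
normalAnswer⇒normal a (_ , inj₂ (inj₁ (closure W (e W′ u)))) with normalAnswer-plugW⁻ W a
... | es b _ _ with answer-plugW⁻ W′ (normalAnswer⇒answer b)
...   | ()
normalAnswer⇒normal a (_ , inj₂ (inj₂ (closure W (gcv t S _ 0∉t)))) with normalAnswer-plugW⁻ W a
... | es _ _ 0∈t = 0∉t 0∈t

_∈fv?_ : ∀ x t → Dec (x ∈fv t)
x ∈fv? var y   = x ≟ y
x ∈fv? lam t   = suc x ∈fv? t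
x ∈fv? app t u = (x ∈fv? t) ⊎-dec (x ∈fv? u)
x ∈fv? es t u  = (suc x ∈fv? t) ⊎-dec (x ∈fv? u)

answer-progress : ∀ {a} → Answer a →
  NormalAnswer a ⊎ ∃ λ a′ → a →w a′ × Answer a′ × #es a ≡ suc (#es a′)
answer-progress (lam t) = inj₁ (lam t)
answer-progress (es {t} {u} a b) with answer-progress a
... | inj₂ (t′ , r , a′ , eq) =
  inj₂ (es t′ u , w-esˡ u r , es a′ b , cong (λ n → suc (n + #es u)) eq)
... | inj₁ na with answer-progress b
...   | inj₂ (u′ , r , b′ , eq) =
  inj₂ (es t u′ , w-esʳ t r , es a b′ ,
        cong suc (trans (cong (#es t +_) eq) (+-suc (#es t) _)))
...   | inj₁ nb with 0 ∈fv? t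
...     | yes 0∈t = inj₁ (es na nb 0∈t)
...     | no  0∉t with answer-view b
...       | view S body refl refill size =
  -- The collected substitution is the one lost in the count: `S` keeps all the substitutions of
  -- `u`, and shifting preserves those of `t`.
  inj₂ (plugS S t′ , gcv-step (gcv t S (lam body) 0∉t) , refill a′ ,
        cong suc (sym (trans (size t′) (cong (_+ #es u) #t′≡#t))))
  where
  t′ = rename (depthS S +_) (rename pred t)
  a′ = answer-rename (depthS S +_) (answer-rename pred a)
  #t′≡#t : #es t′ ≡ #es t
  #t′≡#t = trans (#es-rename (depthS S +_) (answer-rename pred a)) (#es-rename pred a)

answer-normalizing : ∀ n {a} → #es a ≡ n → Answer a → HasNormalForm _→w_ a
answer-normalizing n eq a with answer-progress a
... | inj₁ na = _ , normalAnswer⇒normal na , ε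
answer-normalizing zero    eq a | inj₂ (_ , _ , _ , eq′) with trans (sym eq) eq′
... | ()
answer-normalizing (suc n) eq a | inj₂ (_ , r , a′ , eq′)
  with answer-normalizing n (suc-injective (trans (sym eq′) eq)) a′
... | n , nf , rs = n , nf , r ◅ rs

-- Weak reduction relative to an environment

rename-cong : ∀ {ρ ξ} → (∀ i → ρ i ≡ ξ i) → ∀ t → rename ρ t ≡ rename ξ t
rename-cong eq (var x)   = cong var (eq x)
rename-cong eq (lam t)   = cong lam (rename-cong (ext-cong eq) t)
rename-cong eq (app t u) = cong₂ app (rename-cong eq t) (rename-cong eq u)
rename-cong eq (es t u)  = cong₂ es (rename-cong (ext-cong eq) t) (rename-cong eq u)

rename-∘ : ∀ ρ ξ t → rename ρ (rename ξ t) ≡ rename (ρ ∘ ξ) t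
rename-∘ ρ ξ (var x)   = refl
rename-∘ ρ ξ (lam t)   =
  cong lam (trans (rename-∘ (ext ρ) (ext ξ) t) (rename-cong (ext-∘ ρ ξ) t))
rename-∘ ρ ξ (app t u) = cong₂ app (rename-∘ ρ ξ t) (rename-∘ ρ ξ u)
rename-∘ ρ ξ (es t u)  =
  cong₂ es (trans (rename-∘ (ext ρ) (ext ξ) t) (rename-cong (ext-∘ ρ ξ) t)) (rename-∘ ρ ξ u)

rename-id : ∀ t → rename (λ i → i) t ≡ t
rename-id (var x)   = refl
rename-id (lam t)   = cong lam (trans (rename-cong ext-id t) (rename-id t))
rename-id (app t u) = cong₂ app (rename-id t) (rename-id u)
rename-id (es t u)  = cong₂ es (trans (rename-cong ext-id t) (rename-id t)) (rename-id u)

Env : Set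
Env = ℕ → Term

infixl 6 _▸_
-- All entries live in the scope of the term being reduced, so the new entry is weakened past its
-- own binder as well.
_▸_ : Env → Term → Env
(Γ ▸ u) zero    = rename suc u
(Γ ▸ u) (suc i) = rename suc (Γ i)

-- A lookup is the exponential step of an explicit substitution that lies
-- outside the term and is recorded in the environment.
infix 4 _⊢_⇒_ _⊢_⇒*_
data _⊢_⇒_ (Γ : Env) : Term → Term → Set where
  lookup : ∀ W i → Γ ⊢ plugW′ W (var i) ⇒ plugW′ W (Γ i)
  weak   : ∀ {t u} → t →w u → Γ ⊢ t ⇒ u

_⊢_⇒*_ : Env → Term → Term → Set
Γ ⊢ t ⇒* u = Star (Γ ⊢_⇒_) t u

⇒-appˡ : ∀ {Γ t t′} u → Γ ⊢ t ⇒ t′ → Γ ⊢ app t u ⇒ app t′ u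
⇒-appˡ u (lookup W i) = lookup (appˡ W u) i
⇒-appˡ u (weak r)     = weak (w-appˡ u r)

⇒-appʳ : ∀ {Γ} t {u u′} → Γ ⊢ u ⇒ u′ → Γ ⊢ app t u ⇒ app t u′
⇒-appʳ t (lookup W i) = lookup (appʳ t W) i
⇒-appʳ t (weak r)     = weak (w-appʳ t r)

⇒-esʳ : ∀ {Γ} t {u u′} → Γ ⊢ u ⇒ u′ → Γ ⊢ es t u ⇒ es t u′
⇒-esʳ t (lookup W i) = lookup (esʳ t W) i
⇒-esʳ t (weak r)     = weak (w-esʳ t r)

-- A lookup of index 0 turns into a genuine exponential step of the substitution by `u`; a lookup of
-- any other index remains one, in `Γ`.
⇒-esˡ : ∀ {Γ t t′} u → Γ ▸ u ⊢ t ⇒ t′ → Γ ⊢ es t u ⇒ es t′ u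
⇒-esˡ u (lookup W zero) = weak (e-step (e W u))
⇒-esˡ {Γ} u (lookup W (suc i)) =
  subst₂ (λ s s′ → Γ ⊢ es (plugW W s) u ⇒ es (plugW W s′) u)
    (cong var (sym (+-suc d i)))
    (trans (rename-cong (λ j → sym (+-suc d j)) (Γ i)) (sym (rename-∘ (d +_) suc (Γ i))))
    (lookup (esˡ W u) i)
  where d = depthW W
⇒-esˡ u (weak r) = weak (w-esˡ u r)

-- Nothing is asked where `σ i` has no value. In particular the identity environment realizes
-- `V.var`, which starts the simulation.
Realizes : Env → Sub → Set
Realizes Γ σ = ∀ i {v} → σ i ⇓ v → Answer (Γ i) × Γ i ⟦ σ ⟧ ⇓ v

Realizes-▸ : ∀ {Γ σ a w} → Realizes Γ σ → Answer a → a ⟦ σ ⟧ ⇓ w → Realizes (Γ ▸ a) (w • σ)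
Realizes-▸ {σ = σ} {a} {w} rl ans p zero w⇓v
  with ⇓-deterministic (value-⇓ (⇓-value p)) w⇓v
... | refl = answer-rename suc ans , subst (_⇓ w) (sym (⟦⟧-rename suc a (w • σ))) p
Realizes-▸ {Γ} {σ} {a} {w} rl ans p (suc i) σi⇓v with rl i σi⇓v
... | ans′ , q = answer-rename suc ans′ , subst (_⇓ _) (sym (⟦⟧-rename suc (Γ i) (w • σ))) q

-- After a multiplicative step at a distance, the simulation goes on beneath `S`. The pair `Γ′`,
-- `σ′` is the environment found there, and `reduce`, `answer` and `eval` carry the outcome back
-- outside.
record Opened (Γ : Env) (σ : Sub) (a : Term) (b : Λ) : Set where
  field
    S      : SContext
    body   : Term
    Γ′     : Env
    σ′     : Sub
    shape  : a ≡ plugS S (lam body)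
    value  : b ≡ body ⟦ V.exts σ′ ⟧
    shift  : Extends (depthS S) σ′ σ
    real   : Realizes Γ′ σ′
    reduce : ∀ {t u} → Γ′ ⊢ t ⇒* u → Γ ⊢ plugS S t ⇒* plugS S u
    answer : ∀ {t} → Answer t → Answer (plugS S t)
    eval   : ∀ t {v} → t ⟦ σ′ ⟧ ⇓ v → plugS S t ⟦ σ ⟧ ⇓ v

open-answer : ∀ {Γ σ a b} → Answer a → Realizes Γ σ → a ⟦ σ ⟧ ⇓ V.lam b → Opened Γ σ a b
open-answer {Γ} {σ} (lam t) rl lam = record
  { S = hole ; body = t ; Γ′ = Γ ; σ′ = σ ; shape = refl ; value = refl
  ; shift = λ _ → refl ; real = rl ; reduce = λ r → r ; answer = λ a → a ; eval = λ _ p → p }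
open-answer (es {t} {u} a b) rl p with es-⇓⁻ {t} {u} p
... | w , q , r = record
  { S = esˡ S u ; body = body ; Γ′ = Γ′ ; σ′ = σ′ ; shape = cong (λ s → es s u) shape
  ; value = value ; shift = Extends-suc (depthS S) σ′ shift ; real = real
  ; reduce = gmap (λ s → es s u) (⇒-esˡ u) ∘ reduce
  ; answer = λ c → es (answer c) b
  ; eval = λ s s⇓ → es-⇓ {plugS S s} {u} q (eval s s⇓) }
  where open Opened (open-answer a (Realizes-▸ rl b q) r)

-- The induction is on the evaluation, since the body of a function is not a subterm of the
-- application. The equation on `s` lets the last premise of `app` be passed on untransported, hence
-- visibly smaller.
⇓⇒⇒* : ∀ {Γ σ s v} t → s ≡ t ⟦ σ ⟧ → Realizes Γ σ → s ⇓ v →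
  ∃ λ a → Answer a × Γ ⊢ t ⇒* a × a ⟦ σ ⟧ ⇓ v
⇓⇒⇒* {Γ} (var i) refl rl p with rl i p
... | a , q = Γ i , a , subst (Γ ⊢ var i ⇒*_) (rename-id (Γ i)) (lookup hole i ◅ ε) , q
⇓⇒⇒* (lam t) refl rl lam = lam t , lam t , ε , lam
⇓⇒⇒* (es t u) refl rl (app lam q r) with ⇓⇒⇒* u refl rl q
... | u′ , b , u⇒u′ , u′⇓w
  with ⇓⇒⇒* t (subst-•-exts _ _ (t °)) (Realizes-▸ rl b u′⇓w) r
... | t′ , a , t⇒t′ , t′⇓v =
  es t′ u′ , es a b ,
  gmap (es t) (⇒-esʳ t) u⇒u′ ◅◅ gmap (λ s → es s u′) (⇒-esˡ u′) t⇒t′ ,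
  es-⇓ {t′} {u′} u′⇓w t′⇓v
-- Both sides are reduced to answers before the multiplicative step fires, so that the substitution
-- it creates already contains an answer, `u′` shifted past `S`.
⇓⇒⇒* (app t u) refl rl (app p q r) with ⇓⇒⇒* t refl rl p | ⇓⇒⇒* u refl rl q
... | t′ , a , t⇒t′ , t′⇓ | u′ , b , u⇒u′ , u′⇓ with open-answer a rl t′⇓
... | record { S = S ; body = body ; σ′ = σ′ ; shape = refl ; value = refl ; shift = shift
             ; real = real ; reduce = reduce ; answer = answer ; eval = eval }
  with subst (_⇓ _) (sym (⟦⟧-shift (depthS S) u′ shift)) u′⇓
     | answer-rename (depthS S +_) b
... | ↑u′⇓ | ↑b
  with ⇓⇒⇒* body (subst-•-exts _ _ (body °)) (Realizes-▸ real ↑b ↑u′⇓) r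
... | c , ans , body⇒c , c⇓ =
  plugS S (es c ↑u′) , answer (es ans ↑b) ,
  gmap (λ s → app s u) (⇒-appˡ u) t⇒t′ ◅◅
  gmap (app t′) (⇒-appʳ t′) u⇒u′ ◅◅
  weak (m-step (m S body u′)) ◅
  reduce (gmap (λ s → es s ↑u′) (⇒-esˡ ↑u′) body⇒c) ,
  eval (es c ↑u′) (es-⇓ {c} {↑u′} ↑u′⇓ c⇓)
  where ↑u′ = rename (depthS S +_) u′

⇓⇒w-normalizing : ∀ {t v} → t ⟦ V.var ⟧ ⇓ v → HasNormalForm _→w_ t
-- The realizability premise is vacuous because a variable does not evaluate.
⇓⇒w-normalizing {t} p with ⇓⇒⇒* {Γ = var} t refl (λ _ ()) p
... | a , ans , rs , _ with answer-normalizing (#es a) refl ans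
...   | n , nf , rs′ = n , nf , kleisliStar (λ s → s) identity-env rs ◅◅ rs′
  where
  identity-env : ∀ {t u} → var ⊢ t ⇒ u → Star _→w_ t u
  -- Looking up a variable in the environment `var` gives back the same term.
  identity-env (lookup W i) = ε
  identity-env (weak r)     = r ◅ ε

w-normalizing⇔V-normalizing : ∀ t → Closed t →
  HasNormalForm _→w_ t ⇔ HasNormalForm V._→βv_ (t °)
w-normalizing⇔V-normalizing t cl = mk⇔ to from
  where
  to : HasNormalForm _→w_ t → HasNormalForm V._→βv_ (t °)
  to h with w-normalizing⇒⇓ cl h
  ... | _ , p = ⇓⇒V-normalizing (subst (_⇓ _) (subst-var (t °)) p)
  from : HasNormalForm V._→βv_ (t °) → HasNormalForm _→w_ t
  from h with V-normalizing⇒⇓ (λ x → cl x ∘ ∈fv°⇒∈fv t) h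
  ... | _ , p = ⇓⇒w-normalizing {t} (subst (_⇓ _) (sym (subst-var (t °))) p)

-- Contexts

⌜⌝-rename : ∀ ρ t → ⌜ V.rename ρ t ⌝ ≡ rename ρ ⌜ t ⌝
⌜⌝-rename ρ (V.var x)   = refl
⌜⌝-rename ρ (V.lam t)   = cong lam (⌜⌝-rename (ext ρ) t)
⌜⌝-rename ρ (V.app t u) = cong₂ app (⌜⌝-rename ρ t) (⌜⌝-rename ρ u)

⌜⌝-° : ∀ t → ⌜ t ⌝ ° ≡ t
⌜⌝-° (V.var x)   = refl
⌜⌝-° (V.lam t)   = cong V.lam (⌜⌝-° t)
⌜⌝-° (V.app t u) = cong₂ V.app (⌜⌝-° t) (⌜⌝-° u)

⌜_⌝ᶜ : V.Context → Context
⌜ V.hole ⌝ᶜ     = hole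
⌜ V.lam x C ⌝ᶜ  = lam x ⌜ C ⌝ᶜ
⌜ V.appˡ C t ⌝ᶜ = appˡ ⌜ C ⌝ᶜ ⌜ t ⌝
⌜ V.appʳ t C ⌝ᶜ = appʳ ⌜ t ⌝ ⌜ C ⌝ᶜ

plug-⌜⌝ᶜ : ∀ C t → plug ⌜ C ⌝ᶜ ⌜ t ⌝ ≡ ⌜ V.plug C t ⌝
plug-⌜⌝ᶜ V.hole       t = refl
plug-⌜⌝ᶜ (V.lam x C)  t =
  cong lam (trans (cong (rename (bind x)) (plug-⌜⌝ᶜ C t)) (sym (⌜⌝-rename (bind x) (V.plug C t))))
plug-⌜⌝ᶜ (V.appˡ C u) t = cong (λ s → app s ⌜ u ⌝) (plug-⌜⌝ᶜ C t)
plug-⌜⌝ᶜ (V.appʳ u C) t = cong (app ⌜ u ⌝) (plug-⌜⌝ᶜ C t)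

infix 9 _°ᶜ
_°ᶜ : Context → V.Context
hole °ᶜ       = V.hole
lam x C °ᶜ    = V.lam x (C °ᶜ)
appˡ C t °ᶜ   = V.appˡ (C °ᶜ) (t °)
appʳ t C °ᶜ   = V.appʳ (t °) (C °ᶜ)
subˡ C x u °ᶜ = V.appˡ (V.lam x (C °ᶜ)) (u °)
subʳ t x C °ᶜ = V.appʳ (V.abs x (t °)) (C °ᶜ)

°-abs : ∀ x t → abs x t ° ≡ V.abs x (t °)
°-abs x t = cong V.lam (°-rename (bind x) t)

plug-° : ∀ C t → plug C t ° ≡ V.plug (C °ᶜ) (t °)
plug-° hole         t = refl
plug-° (lam x C)    t = trans (°-abs x (plug C t)) (cong (V.abs x) (plug-° C t))
plug-° (appˡ C u)   t = cong (λ s → V.app s (u °)) (plug-° C t)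
plug-° (appʳ u C)   t = cong (V.app (u °)) (plug-° C t)
plug-° (subˡ C x u) t =
  cong (λ s → V.app s (u °)) (trans (°-abs x (plug C t)) (cong (V.abs x) (plug-° C t)))
plug-° (subʳ u x C) t = cong₂ V.app (°-abs x u) (plug-° C t)

closed°⇒closed : ∀ s {t} → s ° ≡ t → V.Closed t → Closed s
closed°⇒closed s refl cl x = cl x ∘ ∈fv⇒∈fv° s

closed⇒closed° : ∀ s {t} → s ° ≡ t → Closed s → V.Closed t
closed⇒closed° s refl cl x = cl x ∘ ∈fv°⇒∈fv s

-- The translations are given by equations because plugged terms match theirs only propositionally.
equinormalizing-° : ∀ {s s′ t t′} → s ° ≡ t → s′ ° ≡ t′ → Closed s → Closed s′ →
  (HasNormalForm _→w_ s ⇔ HasNormalForm _→w_ s′) ⇔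
  (HasNormalForm V._→βv_ t ⇔ HasNormalForm V._→βv_ t′)
equinormalizing-° {s} {s′} refl refl cl cl′ =
  mk⇔ (λ h → s′⇔ ⇔-∘ (h ⇔-∘ ⇔-sym s⇔)) (λ h → ⇔-sym s′⇔ ⇔-∘ (h ⇔-∘ s⇔))
  where
  s⇔  = w-normalizing⇔V-normalizing s cl
  s′⇔ = w-normalizing⇔V-normalizing s′ cl′

theorem7p6 : ∀ (t u : Λ) → (⌜ t ⌝ ≡S ⌜ u ⌝) ⇔ (t ≡V u)
theorem7p6 t u = mk⇔ S⇒V V⇒S
  where
  S⇒V : ⌜ t ⌝ ≡S ⌜ u ⌝ → t ≡V u
  S⇒V h C clt clu =
    -- Contexts without explicit substitutions suffice for this direction; the converse turns the
    -- substitutions of `C` into β-redexes by `°ᶜ`.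
    Equivalence.to (equinormalizing-° (eq t) (eq u) clt′ clu′) (h ⌜ C ⌝ᶜ clt′ clu′)
    where
    eq : ∀ s → plug ⌜ C ⌝ᶜ ⌜ s ⌝ ° ≡ V.plug C s
    eq s = trans (cong _° (plug-⌜⌝ᶜ C s)) (⌜⌝-° (V.plug C s))
    clt′ = closed°⇒closed (plug ⌜ C ⌝ᶜ ⌜ t ⌝) (eq t) clt
    clu′ = closed°⇒closed (plug ⌜ C ⌝ᶜ ⌜ u ⌝) (eq u) clu
  V⇒S : t ≡V u → ⌜ t ⌝ ≡S ⌜ u ⌝
  V⇒S h C clt clu =
    Equivalence.from (equinormalizing-° (eq t) (eq u) clt clu)
      (h (C °ᶜ) (closed⇒closed° (plug C ⌜ t ⌝) (eq t) clt)
                (closed⇒closed° (plug C ⌜ u ⌝) (eq u) clu))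
    where
    eq : ∀ s → plug C ⌜ s ⌝ ° ≡ V.plug (C °ᶜ) s
    eq s = trans (plug-° C ⌜ s ⌝) (cong (V.plug (C °ᶜ)) (⌜⌝-° s))
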